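{- Let $\widehat{X}$ be a sandpile graph whose sink has no outgoing edges, and let $e\in\mathcal{M}(\widehat{X})$ be an idempotent with $e\neq0$. Then $G_e$ is equal to the sandpile group of $\mathcal{S}(e)$, viewed as a subgroup of $\mathcal{M}(\widehat{X})$ via the natural inclusion.
   Context: A sandpile graph $\widehat{X}$ is a finite weakly connected directed multigraph (loops and multiple edges allowed) with a distinguished vertex, the sink, reachable by a directed path from every vertex; the set $V$ of non-sink vertices is nonempty, and $X$ is the digraph obtained by deleting the sink. A configuration assigns a nonnegative integer number of grains to each non-sink vertex; it is stable if every $v$ holds fewer than $\deg^{+}(v)$ (out-degree) grains. Toppling an unstable vertex sends one grain along each of its out-edges (grains at the sink vanish; the sink never topples); every configuration has a unique stabilization. $\mathcal{M}(\widehat X)$ is the set of stable configurations with $a\oplus b$ = stabilization of $a+b$ (commutative monoid, identity $0$). The sandpile group of a sandpile graph is the minimal ideal of its sandpile monoid, a group consisting of its recurrent elements (elements accessible from every element, where $a$ is accessible from $b$ if $b\oplus x=a$ for some $x$). For an idempotent $e$, $G_e$ is the unique maximal subgroup of $\mathcal M(\widehat X)$ with identity $e$. $\operatorname{supp}(m)$ is the set of vertices holding at least one grain. A cycle is a directed closed path of length $\ge1$ in $X$. For $W\subseteq V$, $\operatorname{cl}(W)$ is the set of $z\in V$ reachable by a (possibly trivial) directed path in $X$ from some $w\in W$. A strongly connected component is a maximal subset of $V$ whose vertices mutually reach each other by paths in $X$; it is cyclic if it contains a cycle. A vertex is acyclic if it lies on no cycle. $A(e)$ is the set of acyclic $v\in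 V$ with $v\notin\operatorname{cl}(\operatorname{supp}(e))$ such that every cyclic strongly connected component reachable from $v$ in $X$ intersects $\operatorname{supp}(e)$. $\mathcal S(e)$ is the subgraph of $\widehat X$ induced on $\operatorname{cl}(\operatorname{supp}(e))\cup A(e)\cup\{\text{sink}\}$ (edges of $\widehat X$ with tail in this set), a sandpile graph with the same sink; its configurations are identified with configurations of $\widehat X$ vanishing outside its non-sink vertices (natural inclusion). -}

module Defs where

open import Data.Nat using (ℕ; zero; suc; _+_; _∸_; _≤_; _<_)
open import Data.Fin using (Fin; _≟_)
open import Data.Bool using (if_then_else_)
open import Data.Product using (Σ; _×_; ∃; ∃-syntax; _,_)
open import Data.Sum using (_⊎_)
open import Data.Unit using (⊤)
open import Relation.Nullary using (¬_)
open import Relation.Nullary.Decidable using (⌊_⌋)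
open import Relation.Binary.PropositionalEquality using (_≡_)

∑ : (n : ℕ) → (Fin n → ℕ) → ℕ
∑ zero    f = 0
∑ (suc n) f = f Fin.zero + ∑ n (λ i → f (Fin.suc i))

-- Raw finite directed multigraph with a distinguished sink.
-- Non-sink vertices are Fin n; the sink is a separate vertex.
-- Multigraphs are given by edge multiplicities.

record Graph : Set where
  field
    n         : ℕ
    arcs      : Fin n → Fin n → ℕ   -- # edges v → w between non-sink vertices (loops allowed)
    toSink    : Fin n → ℕ
    fromSink  : Fin n → ℕ
    sinkLoops : ℕ

module _ (G : Graph) where
  open Graph G

  data Reach : Fin n → Fin n → Set where
    here  : ∀ {v} → Reach v v
    there : ∀ {v w z} → 0 < arcs v w → Reach w z → Reach v z

  data ReachesSink : Fin n → Set where
    direct : ∀ {v} → 0 < toSink v → ReachesSink v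
    via    : ∀ {v w} → 0 < arcs v w → ReachesSink w → ReachesSink v

  -- weak connectivity is implied by reachability of the sink from every vertex
  record IsSandpileGraph : Set where
    field
      nonempty      : 1 ≤ n
      sinkReachable : ∀ v → ReachesSink v

  SinkHasNoOutEdges : Set
  SinkHasNoOutEdges = (∀ v → fromSink v ≡ 0) × sinkLoops ≡ 0

  outdeg : Fin n → ℕ
  outdeg v = ∑ n (arcs v) + toSink v

  Config : Set
  Config = Fin n → ℕ

  _≐_ : Config → Config → Set
  c ≐ d = ∀ v → c v ≡ d v

  _⊞_ : Config → Config → Config
  (c ⊞ d) v = c v + d v

  Stable : Config → Set
  Stable c = ∀ v → c v < outdeg v

  topple : Fin n → Config → Config
  topple v c w = (if ⌊ w ≟ v ⌋ then c w ∸ outdeg v else c w) + arcs v w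

  -- Sandpile monoid of the subgraph of X̂ on the vertex set U ∪ {sink}
  -- (keeping all edges of X̂ with tail in U ∪ {sink}), configurations
  -- identified with configurations of X̂ vanishing outside U.
  -- For U = everything this is M(X̂) itself.

  module OnVertices (U : Fin n → Set) where

    Supported : Config → Set
    Supported c = ∀ v → ¬ U v → c v ≡ 0

    Step : Config → Config → Set
    Step c d = Σ (Fin n) λ v → U v × outdeg v ≤ c v × d ≐ topple v c

    data _⇒*_ : Config → Config → Set where
      done : ∀ {c d} → c ≐ d → c ⇒* d
      step : ∀ {c d s} → Step c d → d ⇒* s → c ⇒* s

    StabilizesTo : Config → Config → Set
    StabilizesTo c s = (c ⇒* s) × Stable s

    Elem : Config → Set
    Elem c = Stable c × Supported c

    IsSum : Config → Config → Config → Set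
    IsSum a b s = StabilizesTo (a ⊞ b) s

    AccessibleFrom : Config → Config → Set
    AccessibleFrom a b = ∃[ x ] (Elem x × IsSum b x a)

    -- recurrent element: accessible from every element.
    -- The sandpile group = the set of recurrent elements.
    Recurrent : Config → Set
    Recurrent a = Elem a × (∀ b → Elem b → AccessibleFrom a b)

    Idempotent : Config → Set
    Idempotent e = Elem e × IsSum e e e

    record IsSubgroupWithIdentity (H : Config → Set) (e : Config) : Set where
      field
        ⊆elems   : ∀ a → H a → Elem a
        has-id   : H e
        closed   : ∀ a b s → H a → H b → IsSum a b s → H s
        identity : ∀ a → H a → IsSum e a a
        inverse  : ∀ a → H a → ∃[ b ] (H b × IsSum a b e)

  module Full = OnVertices (λ _ → ⊤)

  -- membership in G_e, the maximal subgroup with identity e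
  -- (the union of all subgroups with identity e)
  InG : Config → Config → Set₁
  InG e g = Σ (Config → Set) λ H → Full.IsSubgroupWithIdentity H e × H g

  supp : Config → Fin n → Set
  supp c v = 0 < c v

  InCl : Config → Fin n → Set
  InCl e z = ∃[ w ] (supp e w × Reach w z)

  OnCycle : Fin n → Set
  OnCycle v = ∃[ w ] (0 < arcs v w × Reach w v)

  Acyclic : Fin n → Set
  Acyclic v = ¬ OnCycle v

  InSCC : Fin n → Fin n → Set
  InSCC u w = Reach u w × Reach w u

  CyclicSCC : Fin n → Set
  CyclicSCC u = ∃[ w ] (InSCC u w × OnCycle w)

  InA : Config → Fin n → Set
  InA e v = Acyclic v × ¬ InCl e v
          × (∀ u → Reach v u → CyclicSCC u → ∃[ w ] (InSCC u w × supp e w))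

  -- non-sink vertices of S(e): cl(supp e) ∪ A(e)
  InS : Config → Fin n → Set
  InS e v = InCl e v ⊎ InA e v

{-# OPTIONS --safe #-}
-- Say that c leads to s inside a vertex set U if c ⊞ x topples to s for some x
-- vanishing outside U. For an idempotent e, the configurations leading to e are
-- closed under sums, under removal of grains, and under toppling in both
-- directions. So the single grain δ v leads to e for v in supp e, then for every v
-- in cl(supp e) (topple outdeg v grains at v and remove all but one of them), and
-- for v in A(e) by induction along the acyclic part (read the same toppling
-- backwards). Hence every configuration on S(e) leads to e, that is, e is recurrent
-- in S(e), and the recurrent elements of S(e) form a group with identity e.
--
-- Conversely, a grain in a cyclic strongly connected component C can move but never
-- leave C empty. If g lies in G_e and g v > 0, then δ u leads to e for each u
-- reachable from v, so e has a grain in every cyclic component reachable from v.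
-- This puts v in S(e).
--
-- Termination of the toppling process is only needed for a configuration x for which
-- some c ⊞ x is known to stabilize. There it follows from confluence: all
-- stabilizing runs of c ⊞ x have the same length, which bounds the runs of x.
module Submission where

open import Defs
open import Data.Nat using (ℕ; zero; suc; _+_; _*_; _∸_; _≤_; _<_; z≤n; s≤s; _≤?_; _<?_)
open import Data.Nat.Properties hiding (_≟_)
open import Data.Nat.Induction using (<-wellFounded)
open import Data.Fin using (Fin; zero; suc; _≟_)
open import Data.Fin.Properties using (any?; all?)
open import Data.List using (List; []; _∷_; allFin)
open import Data.List.Membership.Propositional using (_∈_)
open import Data.List.Membership.Propositional.Properties using (∈-allFin)
open import Data.List.Relation.Unary.Any using (here; there)
open import Data.Bool using (if_then_else_)
open import Data.Product using (_×_; ∃-syntax; _,_; proj₁; proj₂)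
open import Data.Sum using (_⊎_; inj₁; inj₂)
open import Data.Unit using (⊤; tt)
open import Algebra.Properties.CommutativeSemigroup +-commutativeSemigroup using (interchange; xy∙z≈xz∙y)
open import Induction.WellFounded using (Acc; acc)
open import Function using (_∘_)
open import Function.Bundles using (_⇔_; mk⇔)
open import Relation.Nullary using (¬_; Dec; yes; no; contradiction)
open import Relation.Nullary.Decidable using (⌊_⌋; map′; _×-dec_; _⊎-dec_; _→-dec_; ¬?)
open import Relation.Unary using (Decidable)
open import Relation.Binary.PropositionalEquality using (_≡_; _≢_; refl; sym; trans; cong; cong₂; subst; module ≡-Reasoning)

open ≡-Reasoning

-- Finite sums, unit vectors and indicators.

∑-mono-≤ : ∀ m {f g : Fin m → ℕ} → (∀ i → f i ≤ g i) → ∑ m f ≤ ∑ m g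
∑-mono-≤ zero    f≤g = z≤n
∑-mono-≤ (suc m) f≤g = +-mono-≤ (f≤g zero) (∑-mono-≤ m (f≤g ∘ suc))

∑-mono-< : ∀ m {f g : Fin m → ℕ} → (∀ i → f i ≤ g i) → ∀ j → f j < g j → ∑ m f < ∑ m g
∑-mono-< (suc m) f≤g zero    fj<gj = +-mono-<-≤ fj<gj (∑-mono-≤ m (f≤g ∘ suc))
∑-mono-< (suc m) f≤g (suc j) fj<gj = +-mono-≤-< (f≤g zero) (∑-mono-< m (f≤g ∘ suc) j fj<gj)

∑-zero : ∀ m {f : Fin m → ℕ} → (∀ i → f i ≡ 0) → ∑ m f ≡ 0
∑-zero zero    f≡0 = refl
∑-zero (suc m) f≡0 = cong₂ _+_ (f≡0 zero) (∑-zero m (f≡0 ∘ suc))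

fi≤∑f : ∀ m (f : Fin m → ℕ) i → f i ≤ ∑ m f
fi≤∑f (suc m) f zero    = m≤m+n _ _
fi≤∑f (suc m) f (suc i) = ≤-trans (fi≤∑f m (f ∘ suc) i) (m≤n+m _ (f zero))

δ : ∀ {m} → Fin m → Fin m → ℕ
δ zero    zero    = 1
δ zero    (suc w) = 0
δ (suc v) zero    = 0
δ (suc v) (suc w) = δ v w

δ-refl : ∀ {m} (v : Fin m) → δ v v ≡ 1
δ-refl zero    = refl
δ-refl (suc v) = δ-refl v

δ-≢ : ∀ {m} {v w : Fin m} → w ≢ v → δ v w ≡ 0
δ-≢ {v = zero}  {zero}  w≢v = contradiction refl w≢v
δ-≢ {v = zero}  {suc w} w≢v = refl
δ-≢ {v = suc v} {zero}  w≢v = refl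
δ-≢ {v = suc v} {suc w} w≢v = δ-≢ (w≢v ∘ cong suc)

δ≤ : ∀ {m} {v : Fin m} {c : Fin m → ℕ} → 0 < c v → ∀ w → δ v w ≤ c w
δ≤ {v = v} {c} 0<cv w with w ≟ v
... | yes refl = subst (_≤ c v) (sym (δ-refl v)) 0<cv
... | no  w≢v  = subst (_≤ c w) (sym (δ-≢ w≢v)) z≤n

∑-δ : ∀ m (f : Fin m → ℕ) w → ∑ m (λ v → f v * δ v w) ≡ f w
∑-δ (suc m) f zero    = trans
  (cong₂ _+_ (*-identityʳ (f zero)) (∑-zero m (λ v → *-zeroʳ (f (suc v)))))
  (+-identityʳ (f zero))
∑-δ (suc m) f (suc w) = cong₂ _+_ (*-zeroʳ (f zero)) (∑-δ m (f ∘ suc) w)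

⌈_⌉ : ∀ {P : Set} → Dec P → ℕ
⌈ P? ⌉ = if ⌊ P? ⌋ then 1 else 0

⌈⌉-mono-≤ : ∀ {P Q : Set} (P? : Dec P) (Q? : Dec Q) → (P → Q) → ⌈ P? ⌉ ≤ ⌈ Q? ⌉
⌈⌉-mono-≤ (no _)  Q?      P→Q = z≤n
⌈⌉-mono-≤ (yes p) (yes _) P→Q = s≤s z≤n
⌈⌉-mono-≤ (yes p) (no ¬q) P→Q = contradiction (P→Q p) ¬q

⌈⌉-mono-< : ∀ {P Q : Set} (P? : Dec P) (Q? : Dec Q) → ¬ P → Q → ⌈ P? ⌉ < ⌈ Q? ⌉
⌈⌉-mono-< (yes p) Q?      ¬p q = contradiction p ¬p
⌈⌉-mono-< (no _)  (yes _) ¬p q = s≤s z≤n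
⌈⌉-mono-< (no _)  (no ¬q) ¬p q = contradiction q ¬q

-- Reachability, strongly connected components and closure under arcs.

module Reachability (G : Graph) where
  open Graph G

  reach-trans : ∀ {u v w} → Reach G u v → Reach G v w → Reach G u w
  reach-trans here        q = q
  reach-trans (there a p) q = there a (reach-trans p q)

  arc-reach : ∀ {v w} → 0 < arcs v w → Reach G v w
  arc-reach a = there a here

  -- Warshall's algorithm: paths whose intermediate vertices lie in a given list.
  Within : List (Fin n) → Fin n → Fin n → Set
  Within []      v z = v ≡ z ⊎ 0 < arcs v z
  Within (k ∷ L) v z = Within L v z ⊎ (Within L v k × Within L k z)

  within? : ∀ L v z → Dec (Within L v z)
  within? []      v z = (v ≟ z) ⊎-dec (0 <? arcs v z)
  within? (k ∷ L) v z = within? L v z ⊎-dec (within? L v k ×-dec within? L k z)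

  within-base : ∀ L {v z} → v ≡ z ⊎ 0 < arcs v z → Within L v z
  within-base []      p = p
  within-base (k ∷ L) p = inj₁ (within-base L p)

  within⇒reach : ∀ L {v z} → Within L v z → Reach G v z
  within⇒reach []      (inj₁ refl)    = here
  within⇒reach []      (inj₂ a)       = arc-reach a
  within⇒reach (k ∷ L) (inj₁ p)       = within⇒reach L p
  within⇒reach (k ∷ L) (inj₂ (p , q)) = reach-trans (within⇒reach L p) (within⇒reach L q)

  within-trans : ∀ L {v m z} → m ∈ L → Within L v m → Within L m z → Within L v z
  within-trans (k ∷ L) (here refl) p q = inj₂ (toHead p , fromHead q)
    where
    toHead : ∀ {v} → Within (k ∷ L) v k → Within L v k
    toHead (inj₁ p)       = p
    toHead (inj₂ (p , _)) = p
    fromHead : ∀ {z} → Within (k ∷ L) k z → Within L k z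
    fromHead (inj₁ q)       = q
    fromHead (inj₂ (_ , q)) = q
  within-trans (k ∷ L) (there m∈L) (inj₁ p)       (inj₁ q)       = inj₁ (within-trans L m∈L p q)
  within-trans (k ∷ L) (there m∈L) (inj₁ p)       (inj₂ (q , r)) = inj₂ (within-trans L m∈L p q , r)
  within-trans (k ∷ L) (there m∈L) (inj₂ (o , p)) (inj₁ q)       = inj₂ (o , within-trans L m∈L p q)
  -- Both paths pass through `k`, so the closed walk from `k` via `m` back to `k` is cut out.
  within-trans (k ∷ L) (there m∈L) (inj₂ (o , p)) (inj₂ (q , r)) = inj₂ (o , r)

  reach⇒within : ∀ {v z} → Reach G v z → Within (allFin n) v z
  reach⇒within here        = within-base (allFin n) (inj₁ refl)
  reach⇒within (there a p) =
    within-trans (allFin n) (∈-allFin _) (within-base (allFin n) (inj₂ a)) (reach⇒within p)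

  reach? : ∀ v z → Dec (Reach G v z)
  reach? v z = map′ (within⇒reach (allFin n)) reach⇒within (within? (allFin n) v z)

  onCycle? : Decidable (OnCycle G)
  onCycle? v = any? (λ w → (0 <? arcs v w) ×-dec reach? w v)

  inSCC? : ∀ u → Decidable (InSCC G u)
  inSCC? u w = reach? u w ×-dec reach? w u

  inCl? : ∀ e → Decidable (InCl G e)
  inCl? e z = any? (λ w → (0 <? e w) ×-dec reach? w z)

  inA? : ∀ e → Decidable (InA G e)
  inA? e v = ¬? (onCycle? v) ×-dec ¬? (inCl? e v) ×-dec
    all? (λ u → reach? v u →-dec
                any? (λ w → inSCC? u w ×-dec onCycle? w) →-dec
                any? (λ w → inSCC? u w ×-dec (0 <? e w)))

  inS? : ∀ e → Decidable (InS G e)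
  inS? e v = inCl? e v ⊎-dec inA? e v

  ArcClosed : (Fin n → Set) → Set
  ArcClosed U = ∀ {v w} → 0 < arcs v w → U v → U w

  inCl-arcClosed : ∀ e → ArcClosed (InCl G e)
  inCl-arcClosed e a (s , s∈e , p) = s , s∈e , reach-trans p (arc-reach a)

  -- A cyclic out-neighbour of a vertex of A(e) has its component meet supp e, so it lies in cl(supp e).
  inS-arcClosed : ∀ e → ArcClosed (InS G e)
  inS-arcClosed e a (inj₁ v∈cl) = inj₁ (inCl-arcClosed e a v∈cl)
  inS-arcClosed e {v} {w} a (inj₂ (_ , _ , meets)) with inCl? e w
  ... | yes w∈cl = inj₁ w∈cl
  ... | no  w∉cl = inj₂ (acyclic , w∉cl , λ u p → meets u (there a p))
    where
    acyclic : Acyclic G w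
    acyclic w-cyc with meets w (arc-reach a) (w , (here , here) , w-cyc)
    ... | s , (_ , s→w) , s∈e = w∉cl (s , s∈e , s→w)

  -- The component has a vertex `t` on a cycle. A nontrivial path from `w` to `t` starts with an arc
  -- that stays in the component; a trivial one means `w` is `t`, and the cycle supplies the arc.
  cyclicSCC-successor : ∀ {u w} → CyclicSCC G u → InSCC G u w →
                        ∃[ y ] (0 < arcs w y × InSCC G u y)
  cyclicSCC-successor (t , (u→t , t→u) , y , t→y , y→t) (u→w , w→u)
    with reach-trans w→u u→t
  ... | here       = y , t→y , reach-trans u→t (arc-reach t→y) , reach-trans y→t t→u
  ... | there a p  = _ , a , reach-trans u→w (arc-reach a) , reach-trans p t→u

  #reachable : Fin n → ℕ
  #reachable v = ∑ n (λ z → ⌈ reach? v z ⌉)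

  -- The measure for induction along acyclic vertices: all that `w` reaches is reached by `v`, but
  -- `w` no longer reaches `v`.
  #reachable-< : ∀ {v w} → Acyclic G v → 0 < arcs v w → #reachable w < #reachable v
  #reachable-< {v} {w} v-acyc a = ∑-mono-< n
    (λ z → ⌈⌉-mono-≤ (reach? w z) (reach? v z) (there a)) v
    (⌈⌉-mono-< (reach? w v) (reach? v v) (λ p → v-acyc (w , a , p)) here)

-- Single topplings and their commutation.

module Toppling (G : Graph) where
  open Graph G
  open Reachability G

  private
    C : Set
    C = Config G

    o : Fin n → ℕ
    o = outdeg G

  infix  4 _≋_
  infixl 6 _⊕_
  infixl 7 _·_

  _≋_ : C → C → Set
  _≋_ = _≐_ G

  _⊕_ : C → C → C
  _⊕_ = _⊞_ G

  _·_ : ℕ → C → C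
  (k · c) v = k * c v

  𝟎 : C
  𝟎 v = 0

  ≋-sym : ∀ {c d} → c ≋ d → d ≋ c
  ≋-sym p v = sym (p v)

  ≋-trans : ∀ {c d s} → c ≋ d → d ≋ s → c ≋ s
  ≋-trans p q v = trans (p v) (q v)

  -- Legality makes the truncated subtraction exact. Adding the loss back gives an equation uniform
  -- in `w`, from which `topple-unique` recovers the result by cancellation.
  topple-balance : ∀ {v c} → o v ≤ c v → ∀ w → topple G v c w + o v * δ v w ≡ c w + arcs v w
  topple-balance {v} {c} o≤c w with w ≟ v
  ... | yes refl = begin
    c v ∸ o v + arcs v v + o v * δ v v  ≡⟨ cong (λ z → c v ∸ o v + arcs v v + o v * z) (δ-refl v) ⟩
    c v ∸ o v + arcs v v + o v * 1      ≡⟨ cong (c v ∸ o v + arcs v v +_) (*-identityʳ (o v)) ⟩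
    c v ∸ o v + arcs v v + o v          ≡⟨ xy∙z≈xz∙y (c v ∸ o v) (arcs v v) (o v) ⟩
    c v ∸ o v + o v + arcs v v          ≡⟨ cong (_+ arcs v v) (m∸n+n≡m o≤c) ⟩
    c v + arcs v v                      ∎
  ... | no w≢v = begin
    c w + arcs v w + o v * δ v w  ≡⟨ cong (λ z → c w + arcs v w + o v * z) (δ-≢ w≢v) ⟩
    c w + arcs v w + o v * 0      ≡⟨ cong (c w + arcs v w +_) (*-zeroʳ (o v)) ⟩
    c w + arcs v w + 0            ≡⟨ +-identityʳ _ ⟩
    c w + arcs v w                ∎

  topple-unique : ∀ {v c} {d : C} → o v ≤ c v →
                  (∀ w → d w + o v * δ v w ≡ c w + arcs v w) → topple G v c ≋ d
  topple-unique {v} o≤c balance w =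
    +-cancelʳ-≡ (o v * δ v w) _ _ (trans (topple-balance o≤c w) (sym (balance w)))

  topple-cong : ∀ v {c d} → c ≋ d → topple G v c ≋ topple G v d
  topple-cong v c≋d w =
    cong (λ x → (if ⌊ w ≟ v ⌋ then x ∸ o v else x) + arcs v w) (c≋d w)

  topple-⊕ : ∀ {v c} x → o v ≤ c v → topple G v (c ⊕ x) ≋ topple G v c ⊕ x
  topple-⊕ {v} {c} x o≤c = topple-unique (m≤n⇒m≤n+o (x v) o≤c) λ w → begin
    topple G v c w + x w + o v * δ v w  ≡⟨ xy∙z≈xz∙y (topple G v c w) (x w) _ ⟩
    topple G v c w + o v * δ v w + x w  ≡⟨ cong (_+ x w) (topple-balance o≤c w) ⟩
    c w + arcs v w + x w                ≡⟨ xy∙z≈xz∙y (c w) _ _ ⟩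
    c w + x w + arcs v w                ∎

  topple-gain : ∀ {v w} c → w ≢ v → topple G v c w ≡ c w + arcs v w
  topple-gain {v} {w} c w≢v with w ≟ v
  ... | yes w≡v = contradiction w≡v w≢v
  ... | no  _   = refl

  topple-legal : ∀ {v w} c → w ≢ v → o w ≤ c w → o w ≤ topple G v c w
  topple-legal {v} {w} c w≢v o≤c =
    subst (o w ≤_) (sym (topple-gain c w≢v)) (m≤n⇒m≤n+o (arcs v w) o≤c)

  topple-comm : ∀ {v w c} → v ≢ w → o v ≤ c v → o w ≤ c w →
                topple G v (topple G w c) ≋ topple G w (topple G v c)
  topple-comm {v} {w} {c} v≢w v-legal w-legal =
    topple-unique (topple-legal c v≢w v-legal) λ z →
      +-cancelʳ-≡ (o w * δ w z) _ _ (begin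
        topple G w (topple G v c) z + o v * δ v z + o w * δ w z
          ≡⟨ xy∙z≈xz∙y (topple G w (topple G v c) z) _ _ ⟩
        topple G w (topple G v c) z + o w * δ w z + o v * δ v z
          ≡⟨ cong (_+ o v * δ v z) (topple-balance (topple-legal c (v≢w ∘ sym) w-legal) z) ⟩
        topple G v c z + arcs w z + o v * δ v z
          ≡⟨ xy∙z≈xz∙y (topple G v c z) _ _ ⟩
        topple G v c z + o v * δ v z + arcs w z
          ≡⟨ cong (_+ arcs w z) (topple-balance v-legal z) ⟩
        c z + arcs v z + arcs w z
          ≡⟨ xy∙z≈xz∙y (c z) _ _ ⟩
        c z + arcs w z + arcs v z
          ≡⟨ cong (_+ arcs v z) (topple-balance w-legal z) ⟨
        topple G w c z + o w * δ w z + arcs v z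
          ≡⟨ xy∙z≈xz∙y (topple G w c z) _ _ ⟩
        topple G w c z + arcs v z + o w * δ w z
          ∎)

  -- Toppling runs, confluence and termination.

  infix 4 _⟶[_]_ _↠_

  -- Runs carry their length, on which `stabilize-summand` recurses, and do not mention the vertex
  -- set `U`; `legal∈` recovers membership in `U` from the support.
  data _⟶[_]_ : C → ℕ → C → Set where
    stop : ∀ {c d} → c ≋ d → c ⟶[ 0 ] d
    fire : ∀ {c k s} v → o v ≤ c v → topple G v c ⟶[ k ] s → c ⟶[ suc k ] s

  _↠_ : C → C → Set
  c ↠ d = ∃[ k ] (c ⟶[ k ] d)

  ⟶-respˡ : ∀ {c d k s} → c ≋ d → c ⟶[ k ] s → d ⟶[ k ] s
  ⟶-respˡ c≋d (stop c≋s)      = stop (≋-trans (≋-sym c≋d) c≋s)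
  ⟶-respˡ c≋d (fire v o≤c r)  =
    fire v (subst (o v ≤_) (c≋d v) o≤c) (⟶-respˡ (topple-cong v c≋d) r)

  ⟶-⊕ : ∀ {c d k} x → c ⟶[ k ] d → c ⊕ x ⟶[ k ] d ⊕ x
  ⟶-⊕ x (stop c≋d)     = stop λ v → cong (_+ x v) (c≋d v)
  ⟶-⊕ x (fire v o≤c r) =
    fire v (m≤n⇒m≤n+o (x v) o≤c) (⟶-respˡ (≋-sym (topple-⊕ x o≤c)) (⟶-⊕ x r))

  ↠-respˡ : ∀ {c d s} → c ≋ d → c ↠ s → d ↠ s
  ↠-respˡ c≋d (k , r) = k , ⟶-respˡ c≋d r

  ↠-reflexive : ∀ {c d} → c ≋ d → c ↠ d
  ↠-reflexive c≋d = 0 , stop c≋d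

  ↠-trans : ∀ {c d s} → c ↠ d → d ↠ s → c ↠ s
  ↠-trans (_ , stop c≋d)     q = ↠-respˡ (≋-sym c≋d) q
  ↠-trans (_ , fire v o≤c r) q with ↠-trans (_ , r) q
  ... | k , r′ = suc k , fire v o≤c r′

  ↠-⊕ʳ : ∀ {c d} x → c ↠ d → c ⊕ x ↠ d ⊕ x
  ↠-⊕ʳ x (k , r) = k , ⟶-⊕ x r

  ⊕-comm : ∀ c d → c ⊕ d ≋ d ⊕ c
  ⊕-comm c d v = +-comm (c v) (d v)

  ⊕-assoc : ∀ c d s → (c ⊕ d) ⊕ s ≋ c ⊕ (d ⊕ s)
  ⊕-assoc c d s v = +-assoc (c v) (d v) (s v)

  ↠-⊕ˡ : ∀ {c d} x → c ↠ d → x ⊕ c ↠ x ⊕ d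
  ↠-⊕ˡ {c} {d} x p =
    ↠-respˡ (⊕-comm c x) (↠-trans (↠-⊕ʳ x p) (↠-reflexive (⊕-comm d x)))

  ↠-⊕ : ∀ {c d c′ d′} → c ↠ d → c′ ↠ d′ → c ⊕ c′ ↠ d ⊕ d′
  ↠-⊕ p q = ↠-trans (↠-⊕ʳ _ p) (↠-⊕ˡ _ q)

  -- A run to a stable configuration must topple the unstable `v` at some point. Topplings before
  -- that only add grains to `v`, so its first toppling commutes to the front.
  fire-first : ∀ {c k s v} → Stable G s → c ⟶[ k ] s → o v ≤ c v →
               ∃[ j ] (k ≡ suc j × topple G v c ⟶[ j ] s)
  fire-first {v = v} stable (stop c≋s) o≤c =
    contradiction (stable v) (≤⇒≯ (subst (o v ≤_) (c≋s v) o≤c))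
  fire-first {c} {v = v} stable (fire w w-legal r) v-legal with v ≟ w
  ... | yes refl = _ , refl , r
  ... | no  v≢w with fire-first stable r (topple-legal c v≢w v-legal)
  ... | j , refl , r′ = suc j , refl ,
    fire w (topple-legal c (v≢w ∘ sym) w-legal) (⟶-respˡ (topple-comm v≢w v-legal w-legal) r′)

  -- Each toppling on the way to `d` is moved to the front of the run to `s` and taken off.
  confluence : ∀ {c d s} → Stable G s → c ↠ s → c ↠ d → d ↠ s
  confluence {d = d} {s} stable p (_ , q) = go p q
    where
    go : ∀ {c k} → c ↠ s → c ⟶[ k ] d → d ↠ s
    go p       (stop c≋d)     = ↠-respˡ c≋d p
    go (k , r) (fire v o≤c q) with fire-first stable r o≤c
    ... | j , _ , r′ = go (j , r′) q

  -- A toppling legal in `x` is legal in `c ⊕ x`, so `fire-first` takes it off the run and `k` drops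
  -- by one.
  stabilize-summand : ∀ {c s} k x → Stable G s → c ⊕ x ⟶[ k ] s → ∃[ y ] (x ↠ y × Stable G y)
  stabilize-summand {c} k x stable r with any? (λ v → o v ≤? x v)
  ... | no  none      = x , ↠-reflexive (λ _ → refl) , λ v → ≰⇒> (λ o≤x → none (v , o≤x))
  ... | yes (v , o≤x)
    with fire-first stable (⟶-respˡ (⊕-comm c x) r) (m≤n⇒m≤n+o (c v) o≤x)
  ... | j , refl , r′
    with stabilize-summand {c} j (topple G v x) stable
           (⟶-respˡ (≋-trans (topple-⊕ c o≤x) (⊕-comm (topple G v x) c)) r′)
  ... | y , (k′ , q) , y-stable = y , (suc k′ , fire v o≤x q) , y-stable

  grains↠arcs : ∀ v → o v · δ v ↠ arcs v
  grains↠arcs v = 1 , fire v o≤ (stop (topple-unique o≤ λ w → +-comm (arcs v w) _))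
    where
    o≤ : o v ≤ o v * δ v v
    o≤ = ≤-reflexive (sym (trans (cong (o v *_) (δ-refl v)) (*-identityʳ (o v))))

  -- The relation of leading to a configuration inside a vertex set.

  module _ (U : Fin n → Set) where
    open OnVertices G U using (Supported; AccessibleFrom; done; step) renaming (_⇒*_ to _⇒_)

    ⇒→↠ : ∀ {c d} → c ⇒ d → c ↠ d
    ⇒→↠ (done c≋d) = ↠-reflexive c≋d
    ⇒→↠ (step (v , _ , o≤c , d≋) r) with ⇒→↠ r
    ... | k , r′ = suc k , fire v o≤c (⟶-respˡ d≋ r′)

    supported-⊕ : ∀ {c d} → Supported c → Supported d → Supported (c ⊕ d)
    supported-⊕ sc sd v v∉U = cong₂ _+_ (sc v v∉U) (sd v v∉U)

    infix 4 _Leads_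
    -- A relaxed accessibility: neither `x` nor `s` has to be stable, and topplings are not confined
    -- to `U`.
    _Leads_ : C → C → Set
    c Leads s = ∃[ x ] (Supported x × c ⊕ x ↠ s)

    leads-trans : ∀ {c s t} y → Supported y → c Leads s → s ⊕ y ↠ t → c Leads t
    leads-trans {c} y y-supp (x , x-supp , p) q = x ⊕ y , supported-⊕ x-supp y-supp ,
      ↠-respˡ (⊕-assoc c x y) (↠-trans (↠-⊕ʳ y p) q)

    leads-remove : ∀ {c d s} → Supported d → c ⊕ d Leads s → c Leads s
    leads-remove {c} {d} d-supp (x , x-supp , p) =
      d ⊕ x , supported-⊕ d-supp x-supp , ↠-respˡ (⊕-assoc c d x) p

    leads-mono : ∀ {c d s} → (∀ v → c v ≤ d v) → Supported d → d Leads s → c Leads s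
    leads-mono {c} {d} c≤d d-supp (x , x-supp , p) =
      leads-remove (λ v v∉U → trans (cong (_∸ c v) (d-supp v v∉U)) (0∸n≡0 (c v)))
        (x , x-supp , ↠-respˡ (λ v → cong (_+ x v) (sym (m+[n∸m]≡n (c≤d v)))) p)

    leads-anti-↠ : ∀ {c d s} → c ↠ d → d Leads s → c Leads s
    leads-anti-↠ p (x , x-supp , q) = x , x-supp , ↠-trans (↠-⊕ʳ x p) q

    -- `c ⊕ x` topples both to `d ⊕ x` and to the stable `s`, so confluence joins the former to the
    -- latter.
    leads-↠ : ∀ {c d s} → Stable G s → c ↠ d → c Leads s → d Leads s
    leads-↠ stable p (x , x-supp , q) = x , x-supp , confluence stable q (↠-⊕ʳ x p)

    accessible⇒leads : ∀ {c s} → AccessibleFrom s c → c Leads s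
    accessible⇒leads (x , (_ , x-supp) , r , _) = x , x-supp , ⇒→↠ r

    supported-arcs : ArcClosed U → ∀ {v} → U v → Supported (arcs v)
    supported-arcs closed v∈U w w∉U = n≤0⇒n≡0 (≮⇒≥ (λ a → w∉U (closed a v∈U)))

    module _ (U? : Decidable U) (closed : ArcClosed U) (o>0 : ∀ v → 0 < o v) where

      -- A vertex outside `U` is empty, while its out-degree is positive, so it cannot be unstable.
      legal∈ : ∀ {c v} → Supported c → o v ≤ c v → U v
      legal∈ {c} {v} c-supp o≤c with U? v
      ... | yes v∈U = v∈U
      ... | no  v∉U = contradiction (subst (o v ≤_) (c-supp v v∉U) o≤c) (<⇒≱ (o>0 v))

      supported-topple : ∀ {c v} → Supported c → U v → Supported (topple G v c)
      supported-topple {c} {v} c-supp v∈U w w∉U =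
        trans (topple-gain c λ where refl → w∉U v∈U)
              (supported-⊕ c-supp (supported-arcs closed v∈U) w w∉U)

      ↠→⇒ : ∀ {c d} → Supported c → c ↠ d → c ⇒ d × Supported d
      ↠→⇒ c-supp (_ , stop c≋d)     = done c≋d , λ v v∉U → trans (sym (c≋d v)) (c-supp v v∉U)
      ↠→⇒ c-supp (_ , fire v o≤c r)
        with ↠→⇒ (supported-topple c-supp (legal∈ c-supp o≤c)) (_ , r)
      ... | r′ , d-supp = step (v , legal∈ c-supp o≤c , o≤c , λ _ → refl) r′ , d-supp

      -- The witness `x` is replaced by its stabilization `y`; by confluence `c ⊕ y` still topples
      -- to `s`.
      leads⇒accessible : ∀ {c s} → Stable G s → Supported c → c Leads s → AccessibleFrom s c
      leads⇒accessible {c} stable c-supp (x , x-supp , k , r) with stabilize-summand k x stable r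
      ... | y , x↠y , y-stable = y , (y-stable , y-supp) ,
        proj₁ (↠→⇒ (supported-⊕ c-supp y-supp) (confluence stable (k , r) (↠-⊕ˡ c x↠y))) , stable
        where
        y-supp : Supported y
        y-supp = proj₂ (↠→⇒ x-supp x↠y)

    -- Leading to an idempotent.

    module _ {e : C} (e-stable : Stable G e) (e-supp : Supported e) (e⊕e↠e : e ⊕ e ↠ e) where

      leads-𝟎 : 𝟎 Leads e
      leads-𝟎 = e , e-supp , ↠-reflexive (λ _ → refl)

      -- The witnesses add up: the total topples to `e ⊕ e`, and idempotence finishes.
      leads-⊕ : ∀ {c d} → c Leads e → d Leads e → c ⊕ d Leads e
      leads-⊕ {c} {d} (x , x-supp , p) (y , y-supp , q) = x ⊕ y , supported-⊕ x-supp y-supp ,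
        ↠-respˡ (λ v → interchange (c v) (x v) (d v) (y v)) (↠-trans (↠-⊕ p q) e⊕e↠e)

      leads-· : ∀ k {c} → c Leads e → k · c Leads e
      leads-· zero    p = leads-𝟎
      leads-· (suc k) p = leads-⊕ p (leads-· k p)

      leads-∑ : ∀ m {f : Fin m → C} → (∀ i → f i Leads e) → (λ w → ∑ m (λ i → f i w)) Leads e
      leads-∑ zero    p = leads-𝟎
      leads-∑ (suc m) p = leads-⊕ (p zero) (leads-∑ m (p ∘ suc))

      leads-grains : ∀ {c : C} → (∀ v → 0 < c v → δ v Leads e) → c Leads e
      leads-grains {c} p = leads-anti-↠ (↠-reflexive (λ w → sym (∑-δ n c w)))
        (leads-∑ n λ v → multiple v (c v) refl)
        where
        -- Splitting on the value of `c v` calls on the hypothesis only where `c` has a grain.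
        multiple : ∀ v k → c v ≡ k → k · δ v Leads e
        multiple v zero    _  = leads-𝟎
        multiple v (suc k) eq = leads-· (suc k) (p v (subst (0 <_) (sym eq) (s≤s z≤n)))

      leads-arc : ArcClosed U → ∀ {v w} → U v → 0 < arcs v w → δ v Leads e → δ w Leads e
      leads-arc closed {v} v∈U a p = leads-mono (δ≤ a) (supported-arcs closed v∈U)
        (leads-↠ e-stable (grains↠arcs v) (leads-· (o v) p))

      leads-reach : ArcClosed U → ∀ {v w} → U v → Reach G v w → δ v Leads e → δ w Leads e
      leads-reach closed v∈U here        p = p
      leads-reach closed v∈U (there a r) p =
        leads-reach closed (closed a v∈U) r (leads-arc closed v∈U a p)

      leads-successors : ∀ {v} → 0 < o v → (∀ w → 0 < arcs v w → δ w Leads e) → U v → δ v Leads e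
      leads-successors {v} o>0 p v∈U =
        leads-mono (λ w → subst (_≤ o v * δ v w) (*-identityˡ (δ v w)) (*-monoˡ-≤ (δ v w) o>0)) o·δ-supp
          (leads-anti-↠ (grains↠arcs v) (leads-grains p))
        where
        o·δ-supp : Supported (o v · δ v)
        o·δ-supp w w∉U = trans (cong (o v *_) (δ-≢ {v = v} {w} λ where refl → w∉U v∈U)) (*-zeroʳ (o v))

  -- Persistence of grains in cyclic components.

  HasGrain : Fin n → C → Set
  HasGrain u c = ∃[ w ] (InSCC G u w × supp G c w)

  topple-hasGrain : ∀ {u} → CyclicSCC G u → ∀ v c → HasGrain u c → HasGrain u (topple G v c)
  topple-hasGrain u-cyc v c (w , w∈u , 0<c) with w ≟ v
  ... | no  w≢v  = w , w∈u ,
    subst (0 <_) (sym (topple-gain c w≢v)) (m≤n⇒m≤n+o (arcs v w) 0<c)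
  -- The toppled vertex may lose all its grains, but one of them goes to a successor in the same
  -- component.
  ... | yes refl with cyclicSCC-successor u-cyc w∈u
  ... | y , a , y∈u = y , y∈u , m≤n⇒m≤o+n _ a

  ↠-hasGrain : ∀ {u c d} → CyclicSCC G u → c ↠ d → HasGrain u c → HasGrain u d
  ↠-hasGrain u-cyc (_ , stop c≋d) (w , w∈u , 0<c) = w , w∈u , subst (0 <_) (c≋d w) 0<c
  ↠-hasGrain u-cyc (_ , fire {c = c} v _ r) h =
    ↠-hasGrain u-cyc (_ , r) (topple-hasGrain u-cyc v c h)

  -- The sandpile group of the subgraph and the maximal subgroup at `e`.

  module _ (sandpile : IsSandpileGraph G) where

    outdeg>0 : ∀ v → 0 < o v
    outdeg>0 v with IsSandpileGraph.sinkReachable sandpile v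
    ... | direct a = m≤n⇒m≤o+n _ a
    ... | via {w = w} a _ = m≤n⇒m≤n+o _ (≤-trans a (fi≤∑f n (arcs v) w))

    module _ {e : C} (idem : Full.Idempotent G e) where
      private
        e-stable : Stable G e
        e-stable = proj₁ (proj₁ idem)

        e⊕e↠e : e ⊕ e ↠ e
        e⊕e↠e = ⇒→↠ (λ _ → ⊤) (proj₁ (proj₂ idem))

        S : Fin n → Set
        S = InS G e

        closed : ArcClosed S
        closed = inS-arcClosed e

        module M = OnVertices G (λ _ → ⊤)
        module N = OnVertices G S

      e-supported : N.Supported e
      e-supported v v∉S = n≤0⇒n≡0 (≮⇒≥ λ 0<e → v∉S (inj₁ (v , 0<e , here)))

      cl-leads : ∀ {v} → InCl G e v → _Leads_ S (δ v) e
      cl-leads {v} (w , w∈e , r) =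
        leads-reach S e-stable e-supported e⊕e↠e closed (inj₁ (w , w∈e , here)) r
          (leads-mono S (δ≤ w∈e) e-supported (e , e-supported , e⊕e↠e))

      S-leads : ∀ v → S v → _Leads_ S (δ v) e
      S-leads v = go v (<-wellFounded (#reachable v))
        where
        go : ∀ v → Acc _<_ (#reachable v) → S v → _Leads_ S (δ v) e
        go v _         (inj₁ v∈cl) = cl-leads v∈cl
        -- All successors of `v` lie in `S` again and have smaller `#reachable`, since `v` is
        -- acyclic.
        go v (acc rec) (inj₂ v∈A)  = leads-successors S e-stable e-supported e⊕e↠e (outdeg>0 v)
          (λ w a → go w (rec (#reachable-< (proj₁ v∈A) a)) (closed a (inj₂ v∈A))) (inj₂ v∈A)

      supported-leads : ∀ {c} → N.Supported c → _Leads_ S c e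
      supported-leads {c} c-supp = leads-grains S e-stable e-supported e⊕e↠e grain
        where
        grain : ∀ v → 0 < c v → _Leads_ S (δ v) e
        grain v 0<c with inS? e v
        ... | yes v∈S = S-leads v v∈S
        ... | no  v∉S = contradiction (c-supp v v∉S) (>⇒≢ 0<c)

      leads⇒recurrent : ∀ {s} → N.Elem s → (∀ b → N.Elem b → _Leads_ S b s) → N.Recurrent s
      leads⇒recurrent s-elem leads = s-elem , λ b b-elem →
        leads⇒accessible S (inS? e) closed outdeg>0 (proj₁ s-elem) (proj₂ b-elem) (leads b b-elem)

      recurrent-leads : ∀ {a b} → N.Recurrent a → N.Elem b → _Leads_ S b a
      recurrent-leads {b = b} (_ , a-acc) b-elem =
        accessible⇒leads S (a-acc b b-elem)

      -- Every `b` on `S` leads to `e`; adding `g` to the witness takes it on to `e ⊕ g` and hence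
      -- to `g`.
      identity⇒recurrent : ∀ {g} → N.Elem g → e ⊕ g ↠ g → N.Recurrent g
      identity⇒recurrent {g} g-elem e⊕g↠g = leads⇒recurrent g-elem λ b b-elem →
        leads-trans S g (proj₂ g-elem) (supported-leads (proj₂ b-elem)) e⊕g↠g

      -- Some `e ⊕ x` topples to `a`. Then `e ⊕ e ⊕ x` topples to `a` through `e ⊕ x`, and also to
      -- `e ⊕ a`, so confluence applies.
      recurrent-identity : ∀ {a} → N.Recurrent a → e ⊕ a ↠ a
      recurrent-identity {a} a-rec@((a-stable , _) , _)
        with recurrent-leads a-rec (e-stable , e-supported)
      ... | x , _ , p = confluence a-stable
        (↠-respˡ (⊕-assoc e e x) (↠-trans (↠-⊕ʳ x e⊕e↠e) p)) (↠-⊕ˡ e p)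

      ↠→M : ∀ {c s} → Stable G s → c ↠ s → M.StabilizesTo c s
      ↠→M stable p = proj₁ (↠→⇒ (λ _ → ⊤) (λ _ → yes tt) (λ _ _ → tt) outdeg>0
        (λ v v∉⊤ → contradiction tt v∉⊤) p) , stable

      recurrent-subgroup : M.IsSubgroupWithIdentity N.Recurrent e
      recurrent-subgroup = record
        { ⊆elems   = λ a a-rec → proj₁ (proj₁ a-rec) , λ v v∉⊤ → contradiction tt v∉⊤
        ; has-id   = identity⇒recurrent (e-stable , e-supported) e⊕e↠e
        ; closed   = λ a b s a-rec b-rec a⊕b →
            sum-recurrent a-rec (proj₂ (proj₁ b-rec)) (proj₂ a⊕b) (⇒→↠ _ (proj₁ a⊕b))
        ; identity = λ a a-rec → ↠→M (proj₁ (proj₁ a-rec)) (recurrent-identity a-rec)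
        ; inverse  = inverse
        }
        where
        -- The ideal property: only `a` is recurrent, so `inverse` can apply it to `e ⊕ x` with `x`
        -- merely supported on `S`.
        sum-recurrent : ∀ {a b s} → N.Recurrent a → N.Supported b → Stable G s →
                        a ⊕ b ↠ s → N.Recurrent s
        sum-recurrent {b = b} a-rec b-supp s-stable p = leads⇒recurrent
          (s-stable , proj₂ (↠→⇒ S (inS? e) closed outdeg>0
                               (supported-⊕ S (proj₂ (proj₁ a-rec)) b-supp) p))
          (λ c c-elem → leads-trans S b b-supp (recurrent-leads a-rec c-elem) p)

        -- If a ⊕ x topples to e, the inverse of a is the stabilization of e ⊕ x.
        inverse : ∀ a → N.Recurrent a → ∃[ b ] (N.Recurrent b × M.IsSum a b e)
        inverse a a-rec with supported-leads (proj₂ (proj₁ a-rec))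
        ... | x , x-supp , p
          with ↠-respˡ {d = a ⊕ (e ⊕ x)}
                 (λ v → trans (sym (+-assoc (e v) (a v) (x v)))
                        (trans (cong (_+ x v) (+-comm (e v) (a v))) (+-assoc (a v) (e v) (x v))))
                 (↠-trans (↠-⊕ˡ e p) e⊕e↠e)
        ... | k , r with stabilize-summand {a} k (e ⊕ x) e-stable r
        ... | b , e⊕x↠b , b-stable = b ,
          sum-recurrent (identity⇒recurrent (e-stable , e-supported) e⊕e↠e) x-supp b-stable e⊕x↠b ,
          ↠→M e-stable (confluence e-stable (k , r) (↠-⊕ˡ a e⊕x↠b))

      summand-supported : ∀ {g h} → g ⊕ h ↠ e → N.Supported g
      summand-supported {g} {h} g⊕h↠e v v∉S = n≤0⇒n≡0 (≮⇒≥ λ 0<g → v∉S (inj₂ (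
          -- If `v` lay on a cycle, its own component would meet the support of `e`, which would put
          -- `v` in the closure.
          (λ v-cyc → v∉cl (cycle∈cl (meets 0<g v here (v , (here , here) , v-cyc))))
        , v∉cl
        , meets 0<g)))
        where
        v∉cl : ¬ InCl G e v
        v∉cl v∈cl = v∉S (inj₁ v∈cl)

        cycle∈cl : HasGrain v e → InCl G e v
        cycle∈cl (w , (_ , w→v) , w∈e) = w , w∈e , w→v

        supp⊤ : ∀ {c} → M.Supported c
        supp⊤ v v∉⊤ = contradiction tt v∉⊤

        meets : 0 < g v → ∀ u → Reach G v u → CyclicSCC G u → HasGrain u e
        meets 0<g u r u-cyc
          -- The vertex set is all of `V` here, because `h` is not known to be supported on `S`.
          with leads-reach (λ _ → ⊤) e-stable supp⊤ e⊕e↠e (λ _ _ → tt) tt r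
                 (leads-mono (λ _ → ⊤) (δ≤ 0<g) supp⊤ (h , supp⊤ , g⊕h↠e))
        ... | x , _ , p = ↠-hasGrain u-cyc p
          (u , (here , here) , m≤n⇒m≤n+o (x u) (≤-reflexive (sym (δ-refl u))))

      inG⇒recurrent : ∀ {g} → InG G e g → N.Recurrent g
      inG⇒recurrent {g} (H , H-subgroup , g∈H) with inverse g g∈H
        where open M.IsSubgroupWithIdentity H-subgroup
      ... | h , _ , g⊕h = identity⇒recurrent
        (proj₁ (⊆elems g g∈H) , summand-supported (⇒→↠ _ (proj₁ g⊕h)))
        (⇒→↠ _ (proj₁ (identity g g∈H)))
        where open M.IsSubgroupWithIdentity H-subgroup

theorem3p7 : (G : Graph) → IsSandpileGraph G → SinkHasNoOutEdges G →
    (e : Config G) → Full.Idempotent G e →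
    ¬ (∀ v → e v ≡ 0) →
    (g : Config G) → InG G e g ⇔ OnVertices.Recurrent G (InS G e) g
theorem3p7 G sandpile _ e idem _ g = mk⇔
  (inG⇒recurrent sandpile idem)
  -- The recurrent elements themselves are the subgroup that witnesses membership of `g`.
  (λ g-rec → OnVertices.Recurrent G (InS G e) , recurrent-subgroup sandpile idem , g-rec)
  where open Toppling G
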